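{- Let $p\ge 3$ be an odd integer and let $G=(V,E)$ be a good finite hypergraph. Let $w_1\in \mathbf{Z}_p^{V}$ be an initial configuration that is not identically zero, and let $w_2\in\mathbf{Z}_p^{V}$ be a final configuration that is not the configuration all of whose entries equal $-1$. Then $w_2$ is reachable from $w_1$ if and only if the linear system $H(w_1,w_2,G)$ has a solution in $\mathbf{Z}_p$.
   Context: $\mathbf{Z}_p$ is the ring of integers modulo $p$. A hypergraph $G=(V,E)$ has a finite vertex set $V$ and a set $E$ of hyperedges, which are subsets of $V$. A hypergraph is called good if it is connected and every hyperedge $e\in E$ satisfies $|e|\ge 3$. Dynamics ($\mathbf{Z}_p$-annihilating walk on $G$): a state (configuration) is a vector $w\in\mathbf{Z}_p^{V}$. An allowed move from a state $w$ consists of choosing a vertex $v$ with $w[v]\ne 0$ and a hyperedge $e$ containing $v$, and then replacing $w[v]$ by $w[v]-1$ and $w[u]$ by $w[u]+1$ for every $u\in e\setminus\{v\}$ (all arithmetic mod $p$; other entries are unchanged). A state $w'$ is reachable from $w$ if it can be obtained from $w$ by a finite (possibly empty) sequence of allowed moves. The system $H(w_1,w_2,G)$ has unknowns $X_{e,v}\in\mathbf{Z}_p$, one for each pair consisting of a hyperedge $e$ and a vertex $v\in e$, and one equation for each vertex $v\in V$: $$\sum_{e\ni v}\ \sum_{u\in e,\,u\neq v} X_{e,u}\;-\;\sum_{e\ni v} X_{e,v}\;=\;w_2[v]-w_1[v]\pmod p .$$ -}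

module Defs where

open import Data.Nat.Base as ℕ using (ℕ; NonZero; _∸_; _≥_)
open import Data.Nat.DivMod using (_mod_)
open import Data.Fin.Base using (Fin; toℕ)
open import Data.Fin.Properties using (_≟_)
open import Data.Fin.Subset using (Subset; _∈_; _∉_; ∣_∣)
open import Data.Fin.Subset.Properties using (_∈?_)
open import Data.Product.Base using (_×_; _,_; ∃-syntax)
open import Data.Vec.Base using (Vec; lookup)
import Data.Vec.Functional as Functional
open import Function.Definitions using (Injective)
open import Relation.Binary.Construct.Closure.ReflexiveTransitive using (Star)
open import Relation.Binary.PropositionalEquality using (_≡_; _≢_)
open import Relation.Nullary.Decidable using (Dec; yes; no; ¬?; _×-dec_)

-- Integers modulo p, as canonical representatives, so that _≡_ is equality
-- in the ring and no quotient is needed.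

ℤ/ : ℕ → Set
ℤ/ p = Fin p

module _ {p : ℕ} .{{_ : NonZero p}} where

  infixl 6 _⊕_ _⊖_
  infix  8 ⊝_

  0ₚ 1ₚ : ℤ/ p
  0ₚ = 0 mod p
  1ₚ = 1 mod p

  _⊕_ : ℤ/ p → ℤ/ p → ℤ/ p
  a ⊕ b = (toℕ a ℕ.+ toℕ b) mod p

  ⊝_ : ℤ/ p → ℤ/ p
  ⊝ a = (p ∸ toℕ a) mod p

  _⊖_ : ℤ/ p → ℤ/ p → ℤ/ p
  a ⊖ b = a ⊕ (⊝ b)

  ∑ : {k : ℕ} → (Fin k → ℤ/ p) → ℤ/ p
  ∑ = Functional.foldr _⊕_ 0ₚ

  -- ∑ (λ i → [ P? i ]· λ Pi → f i Pi) is the sum of f over those i satisfying P.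
  infix 5 [_]·_
  [_]·_ : {P : Set} → Dec P → (P → ℤ/ p) → ℤ/ p
  [ yes x ]· f = f x
  [ no  _ ]· f = 0ₚ

-- The vertex set is Fin order. Injectivity of edge makes the hyperedges a set:
-- no subset is listed twice.
record Hypergraph : Set where
  field
    order         : ℕ
    size          : ℕ
    edge          : Fin size → Subset order
    edge-distinct : Injective _≡_ _≡_ edge

  Vertex : Set
  Vertex = Fin order

  Edge : Set
  Edge = Fin size

  Adjacent : Vertex → Vertex → Set
  Adjacent u v = ∃[ e ] (u ∈ edge e × v ∈ edge e)

  Connected : Set
  Connected = ∀ u v → Star Adjacent u v

  Good : Set
  Good = Connected × (∀ e → ∣ edge e ∣ ≥ 3)

module _ (G : Hypergraph) where
  open Hypergraph G

  State : ℕ → Set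
  State p = Vec (ℤ/ p) order

  record Move {p : ℕ} .{{_ : NonZero p}} (w w′ : State p) : Set where
    field
      v         : Vertex
      e         : Edge
      v∈e       : v ∈ edge e
      nonzero   : lookup w v ≢ 0ₚ
      decrement : lookup w′ v ≡ lookup w v ⊖ 1ₚ
      increment : ∀ u → u ∈ edge e → u ≢ v → lookup w′ u ≡ lookup w u ⊕ 1ₚ
      unchanged : ∀ u → u ∉ edge e → lookup w′ u ≡ lookup w u

  Reachable : {p : ℕ} .{{_ : NonZero p}} → State p → State p → Set
  Reachable = Star Move

  Unknowns : ℕ → Set
  Unknowns p = (e : Edge) (v : Vertex) → v ∈ edge e → ℤ/ p

  SolvesH : {p : ℕ} .{{_ : NonZero p}} → State p → State p → Unknowns p → Set
  SolvesH w₁ w₂ X = ∀ v →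
      ∑ (λ e → [ v ∈? edge e ]· λ _ →
        ∑ (λ u → [ (u ∈? edge e) ×-dec ¬? (u ≟ v) ]· λ (u∈e , _) → X e u u∈e))
    ⊖ ∑ (λ e → [ v ∈? edge e ]· λ v∈e → X e v v∈e)
    ≡ lookup w₂ v ⊖ lookup w₁ v

{-# OPTIONS --safe #-}
module Submission where

-- Moves at v along e add a fixed vector, pulse e v, so reachability implies that
-- the system is solvable, and a solution prescribes how often each pulse is to be
-- added; what has to be overcome is the condition w[v] ≠ 0.  On a single edge a
-- blocked vertex can be unblocked by other vertices of that edge, which are then
-- fired further until their contribution is a multiple of p.  Thus a pulse on e
-- can be added whenever the configurations before and after are both
-- nonconstant on e.  For a set L of pulses, "L connects e" means that
-- configurations that are nonconstant on e and differ by a combination of L are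
-- reachable from each other.  Temporary perturbations that keep the relevant
-- edges nonconstant (possible as p is odd and edges have at least three vertices)
-- let L grow by an adjacent edge, and let e move to an adjacent edge.  Walking
-- through the whole hypergraph, L becomes everything.  Finally a configuration ≠ 0
-- reaches one that is nonconstant on e, and dually one ≠ -1 is reached from one.

open import Defs
open import Data.Bool.Base using (if_then_else_)
open import Data.Empty using (⊥-elim)
open import Data.Fin.Base using (Fin; zero; suc; toℕ; fromℕ<)
open import Data.Fin.Properties using (_≟_; toℕ<n; toℕ-fromℕ<; toℕ-injective; ¬∀⟶∃¬)
open import Data.Fin.Subset using (Subset; _∈_; _∉_; inside; outside) renaming (∣_∣ to card; _-_ to _∖_)
open import Data.Fin.Subset.Properties using (_∈?_; nonempty?; Empty-unique; ∣⊥∣≡0; p─⊥≡p; p─q⊆p)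
open import Data.Integer.Base using (ℤ; +_; _+_; _-_; _*_; -_; 0ℤ; 1ℤ; ∣_∣)
open import Data.Integer.DivMod using (_%ℕ_; _/ℕ_; n%ℕd<d; a≡a%ℕn+[a/ℕn]*n)
open import Data.Integer.Divisibility.Signed
  using (_∣_; divides; _∣?_; ∣-refl; ∣⇒∣ᵤ; ∣m∣n⇒∣m+n; ∣m∣n⇒∣m-n; ∣m⇒∣-m; ∣n⇒∣m*n; ∣m⇒∣m*n)
open import Data.Integer.Properties
  using (+-0-commutativeMonoid; +-assoc; +-comm; +-identityʳ; +-injective; *-zeroʳ; pos-+; pos-*;
         m-n≡m⊖n; ⊖-≥; ∣m⊝n∣≤m⊔n; ∣i∣≡0⇒i≡0; i-j≡0⇒i≡j)
open import Data.Integer.Tactic.RingSolver using (solve-∀)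
open import Data.List.Base using ([]; _∷_; allFin)
open import Data.List.Membership.Propositional.Properties using (∈-allFin)
open import Data.List.Relation.Unary.All as All using (All; []; _∷_)
open import Data.Nat.Base as ℕ using (ℕ; zero; suc; NonZero; _≥_; pred)
open import Data.Nat.Divisibility using (_∤_; >⇒∤; m%n≡0⇒n∣m)
import Data.Nat.Divisibility as ℕ using (_∣_)
import Data.Nat.DivMod as ℕ using (m≡m%n+[m/n]*n; m%n<n)
import Data.Nat.Properties as ℕ
open import Data.Product.Base using (_×_; _,_; ∃-syntax; proj₁; proj₂)
open import Data.Sum.Base using (_⊎_; inj₁; inj₂; [_,_]′)
open import Data.Unit.Base using (⊤; tt)
open import Data.Vec.Base using (lookup; tabulate; replicate; _∷_; there)
open import Data.Vec.Properties using (lookup∘tabulate; tabulate-cong; tabulate∘lookup; lookup-replicate)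
open import Data.Vec.Properties.WithK using ([]=-irrelevant)
open import Function.Base using (_∘_)
open import Function.Bundles using (_⇔_; mk⇔; module Equivalence)
open import Relation.Binary.Construct.Closure.ReflexiveTransitive using (Star; ε; _◅_; _◅◅_)
open import Relation.Binary.PropositionalEquality
open import Relation.Nullary using (¬_; Dec; yes; no; does; contradiction)
open import Relation.Nullary.Decidable using (¬?; _×-dec_; toSum)

open import Algebra.Properties.CommutativeMonoid.Sum +-0-commutativeMonoid using (sum; sum-cong-≗; ∑-distrib-+)

-- Subsets with at least three elements, gated values and finite integer sums

size-remove : ∀ {n} (S : Subset n) x → card S ℕ.≤ suc (card (S ∖ x))
size-remove (inside ∷ S)  zero    = ℕ.s≤s (ℕ.≤-reflexive (sym (cong card (p─⊥≡p S))))
size-remove (outside ∷ S) zero    = ℕ.m≤n⇒m≤1+n (ℕ.≤-reflexive (sym (cong card (p─⊥≡p S))))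
size-remove (inside ∷ S)  (suc x) = ℕ.s≤s (size-remove S x)
size-remove (outside ∷ S) (suc x) = size-remove S x

remove-∉ : ∀ {n} (S : Subset n) x → x ∉ S ∖ x
remove-∉ (inside ∷ S)  zero    ()
remove-∉ (outside ∷ S) zero    ()
remove-∉ (_ ∷ S)       (suc x) (there x∈) = remove-∉ S x x∈

inhabited : ∀ {n} {S : Subset n} → card S ≥ 1 → ∃[ x ] (x ∈ S)
inhabited {n} {S} S≥1 with nonempty? S
... | yes x∈S   = x∈S
... | no  empty = contradiction (subst (λ T → card T ≥ 1) (Empty-unique empty) S≥1)
                                (ℕ.<⇒≱ (ℕ.s≤s (ℕ.≤-reflexive (∣⊥∣≡0 n))))

-- Removing two elements lowers the size by at most two, so something is left. With `a` and `b`
-- equal it yields an element different from one given vertex.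
∃-third : ∀ {n} (S : Subset n) → card S ≥ 3 → ∀ a b → ∃[ c ] (c ∈ S × c ≢ a × c ≢ b)
∃-third S S≥3 a b with inhabited {S = S ∖ a ∖ b} (ℕ.s≤s⁻¹ (ℕ.s≤s⁻¹
        (ℕ.≤-trans S≥3 (ℕ.≤-trans (size-remove S a) (ℕ.s≤s (size-remove (S ∖ a) b))))))
... | c , c∈ = c , p─q⊆p S _ (p─q⊆p (S ∖ a) _ c∈)
                 , (λ { refl → remove-∉ S a (p─q⊆p (S ∖ a) _ c∈) })
                 , (λ { refl → remove-∉ (S ∖ a) b c∈ })

-- Integer counterpart of `[_]·_`; the value does not depend on the proof of `P`.
gate : ∀ {P : Set} → Dec P → ℤ → ℤ
gate d a = if does d then a else 0ℤ

gate-0 : ∀ {P : Set} (d : Dec P) → gate d 0ℤ ≡ 0ℤ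
gate-0 (yes _) = refl
gate-0 (no _)  = refl

gate-yes : ∀ {P : Set} (d : Dec P) {a} → P → gate d a ≡ a
gate-yes (yes _) _ = refl
gate-yes (no ¬x) x = contradiction x ¬x

gate-no : ∀ {P : Set} (d : Dec P) {a} → ¬ P → gate d a ≡ 0ℤ
gate-no (yes x) ¬x = contradiction x ¬x
gate-no (no _)  _  = refl

sum-zero : ∀ {k} (f : Fin k → ℤ) → (∀ i → f i ≡ 0ℤ) → sum f ≡ 0ℤ
sum-zero {zero}  f f≡0 = refl
sum-zero {suc k} f f≡0 = cong₂ _+_ (f≡0 zero) (sum-zero (f ∘ suc) (f≡0 ∘ suc))

sum-single : ∀ {k} (f : Fin k → ℤ) i → (∀ j → j ≢ i → f j ≡ 0ℤ) → sum f ≡ f i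
sum-single f zero    f≡0 =
  trans (cong (_+_ (f zero)) (sum-zero (f ∘ suc) (λ j → f≡0 (suc j) λ ()))) (+-identityʳ (f zero))
sum-single f (suc i) f≡0 =
  trans (cong₂ _+_ (f≡0 zero λ ()) (sum-single (f ∘ suc) i (λ j j≢i → f≡0 (suc j) λ { refl → j≢i refl })))
        (lemma (f (suc i)))
  where
  lemma : ∀ a → 0ℤ + a ≡ a
  lemma = solve-∀

-- Integers modulo p

module Residue (p : ℕ) .{{_ : NonZero p}} where

  Null : ℤ → Set
  Null a = + p ∣ a

  null? : ∀ a → Dec (Null a)
  null? a = + p ∣? a

  null-≡ : ∀ {a b} → a ≡ b → Null a → Null b
  null-≡ = subst Null

  null-+ : ∀ {a b} → Null a → Null b → Null (a + b)
  null-+ = ∣m∣n⇒∣m+n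

  null-- : ∀ {a b} → Null a → Null b → Null (a - b)
  null-- = ∣m∣n⇒∣m-n

  null-neg : ∀ {a} → Null a → Null (- a)
  null-neg = ∣m⇒∣-m

  null-* : ∀ k {a} → Null a → Null (k * a)
  null-* = ∣n⇒∣m*n

  null-p* : ∀ a → Null (+ p * a)
  null-p* a = ∣m⇒∣m*n a ∣-refl

  null-0 : Null 0ℤ
  null-0 = divides 0ℤ refl

  null-self : ∀ a → Null (a - a)
  null-self a = null-≡ (sym (lemma a)) null-0
    where
    lemma : ∀ a → a - a ≡ 0ℤ
    lemma = solve-∀

  residue : ℤ → ℤ/ p
  residue a = fromℕ< (n%ℕd<d a p)

  residue-null : ∀ a → Null (+ toℕ (residue a) - a)
  residue-null a = divides (- (a /ℕ p)) (begin
    + toℕ (residue a) - a          ≡⟨ cong (λ r → + r - a) (toℕ-fromℕ< (n%ℕd<d a p)) ⟩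
    + r - a                        ≡⟨ cong (_-_ (+ r)) (a≡a%ℕn+[a/ℕn]*n a p) ⟩
    + r - (+ r + (a /ℕ p) * + p)   ≡⟨ lemma (+ r) (a /ℕ p) (+ p) ⟩
    - (a /ℕ p) * + p               ∎)
    where
    open ≡-Reasoning
    r = a %ℕ p
    lemma : ∀ r q p → r - (r + q * p) ≡ - q * p
    lemma = solve-∀

  -- Two canonical representatives differ by less than `p` in absolute value, and the only such
  -- multiple of `p` is 0.
  null-residues : ∀ (x y : ℤ/ p) → Null (+ toℕ x - + toℕ y) → x ≡ y
  null-residues x y n =
    toℕ-injective (+-injective (i-j≡0⇒i≡j (+ toℕ x) (+ toℕ y) (∣i∣≡0⇒i≡0 (small _ bound (∣⇒∣ᵤ n)))))
    where
    bound : ∣ + toℕ x - + toℕ y ∣ ℕ.< p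
    bound = subst (λ z → ∣ z ∣ ℕ.< p) (sym (m-n≡m⊖n (toℕ x) (toℕ y)))
              (ℕ.≤-<-trans (∣m⊝n∣≤m⊔n (toℕ x) (toℕ y)) (ℕ.⊔-pres-<m (toℕ<n x) (toℕ<n y)))
    small : ∀ m → m ℕ.< p → p ℕ.∣ m → m ≡ 0
    small zero    _   _   = refl
    small (suc m) m<p p∣m = contradiction p∣m (>⇒∤ m<p)

  residue-cong : ∀ {a b} → Null (a - b) → residue a ≡ residue b
  residue-cong {a} {b} n = null-residues _ _
    (null-≡ (lemma a b (+ toℕ (residue a)) (+ toℕ (residue b))) (null-+ (null-- (residue-null a) (residue-null b)) n))
    where
    lemma : ∀ a b x y → (x - a) - (y - b) + (a - b) ≡ x - y
    lemma = solve-∀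

  residue-injective : ∀ {a b} → residue a ≡ residue b → Null (a - b)
  residue-injective {a} {b} eq = null-≡ (lemma a b (+ toℕ (residue b))) (null-- (residue-null b)
    (subst (λ r → Null (+ toℕ r - a)) eq (residue-null a)))
    where
    lemma : ∀ a b x → (x - b) - (x - a) ≡ a - b
    lemma = solve-∀

  residue-toℕ : ∀ x → residue (+ toℕ x) ≡ x
  residue-toℕ x = null-residues _ _ (residue-null (+ toℕ x))

  ⊕-residue : ∀ a b → residue a ⊕ residue b ≡ residue (a + b)
  ⊕-residue a b = residue-cong {+ (toℕ (residue a) ℕ.+ toℕ (residue b))} {a + b}
    (null-≡ (trans (lemma a b (+ toℕ (residue a)) (+ toℕ (residue b)))
                   (cong (_- (a + b)) (sym (pos-+ (toℕ (residue a)) (toℕ (residue b))))))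
      (null-+ (residue-null a) (residue-null b)))
    where
    lemma : ∀ a b x y → (x - a) + (y - b) ≡ x + y - (a + b)
    lemma = solve-∀

  ⊝-residue : ∀ a → ⊝ residue a ≡ residue (- a)
  ⊝-residue a = residue-cong {+ (p ℕ.∸ toℕ r)} { - a}
    (null-≡ (trans (lemma (+ p) a (+ toℕ r)) (cong (λ z → z - - a)
        (trans (m-n≡m⊖n p (toℕ r)) (⊖-≥ (ℕ.<⇒≤ (toℕ<n r))))))
      (null-- ∣-refl (residue-null a)))
    where
    r = residue a
    lemma : ∀ p a x → p - (x - a) ≡ p - x - - a
    lemma = solve-∀

  ⊖-residue : ∀ a b → residue a ⊖ residue b ≡ residue (a - b)
  ⊖-residue a b = trans (cong (residue a ⊕_) (⊝-residue b)) (⊕-residue a (- b))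

  -- Consequences of an odd modulus

  module Odd (p≥3 : p ≥ 3) (2∤p : 2 ∤ p) where

    -- Since `p` is odd, p = 1 + 2h, and hence a = p a - h (a + a).
    null-half : ∀ a → Null (a + a) → Null a
    null-half a n =
      null-≡ (trans (cong (λ q → q * a - + h * (a + a)) p≡) (lemma (+ h) a))
        (null-- (null-p* a) (null-* (+ h) n))
      where
      h = p ℕ./ 2
      odd : p ℕ.% 2 ≡ 1
      odd with p ℕ.% 2 in eq | ℕ.m%n<n p 2
      ... | 0 | _ = contradiction (m%n≡0⇒n∣m p 2 eq) 2∤p
      ... | 1 | _ = refl
      ... | suc (suc _) | ℕ.s≤s (ℕ.s≤s ())
      p≡ : + p ≡ 1ℤ + + h * + 2
      p≡ = trans (cong +_ (trans (ℕ.m≡m%n+[m/n]*n p 2) (cong (ℕ._+ h ℕ.* 2) odd)))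
             (trans (pos-+ 1 (h ℕ.* 2)) (cong (_+_ 1ℤ) (pos-* h 2)))
      lemma : ∀ h a → (1ℤ + h * + 2) * a - h * (a + a) ≡ a
      lemma = solve-∀

    ¬null-< : ∀ k → suc k ℕ.< p → ¬ Null (+ suc k)
    ¬null-< k k<p n = >⇒∤ k<p (∣⇒∣ᵤ n)

    ¬null-1 : ¬ Null 1ℤ
    ¬null-1 = ¬null-< 0 (ℕ.≤-trans (ℕ.s≤s (ℕ.s≤s ℕ.z≤n)) p≥3)

    ¬null-2 : ¬ Null (+ 2)
    ¬null-2 n = ¬null-1 (null-half 1ℤ n)

    ¬null--1 : ¬ Null (- 1ℤ)
    ¬null--1 n = ¬null-1 (null-neg n)

    ¬null--2 : ¬ Null (- + 2)
    ¬null--2 n = ¬null-2 (null-neg n)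

    apart₀₁ : ∀ d {δ} → ¬ Null δ → Null (d + 0ℤ * δ) → ¬ Null (d + 1ℤ * δ)
    apart₀₁ d {δ} δ≢0 a b = δ≢0 (null-≡ (lemma d δ) (null-- b a))
      where
      lemma : ∀ d δ → d + 1ℤ * δ - (d + 0ℤ * δ) ≡ δ
      lemma = solve-∀

    apart₁₂ : ∀ d {δ} → ¬ Null δ → Null (d + 1ℤ * δ) → ¬ Null (d + + 2 * δ)
    apart₁₂ d {δ} δ≢0 a b = δ≢0 (null-≡ (lemma d δ) (null-- b a))
      where
      lemma : ∀ d δ → d + + 2 * δ - (d + 1ℤ * δ) ≡ δ
      lemma = solve-∀

    apart₀₂ : ∀ d {δ} → ¬ Null δ → Null (d + 0ℤ * δ) → ¬ Null (d + + 2 * δ)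
    apart₀₂ d {δ} δ≢0 a b = δ≢0 (null-half δ (null-≡ (lemma d δ) (null-- b a)))
      where
      lemma : ∀ d δ → d + + 2 * δ - (d + 0ℤ * δ) ≡ δ + δ
      lemma = solve-∀

    -- Of the three values j = 0, 1, 2, each of the two conditions excludes at
    -- most one, because δᵢ and 2 δᵢ do not vanish.
    avoid-two : ∀ d₁ δ₁ d₂ δ₂ → ¬ Null δ₁ → ¬ Null δ₂ →
      ∃[ j ] (¬ Null (d₁ + + j * δ₁) × ¬ Null (d₂ + + j * δ₂))
    avoid-two d₁ δ₁ d₂ δ₂ δ₁≢0 δ₂≢0 with try 0 | try 1
      where
      try : ∀ j → (¬ Null (d₁ + + j * δ₁) × ¬ Null (d₂ + + j * δ₂)) ⊎
                  (Null (d₁ + + j * δ₁) ⊎ Null (d₂ + + j * δ₂))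
      try j with null? (d₁ + + j * δ₁) | null? (d₂ + + j * δ₂)
      ... | yes a | _     = inj₂ (inj₁ a)
      ... | no _  | yes b = inj₂ (inj₂ b)
      ... | no a  | no b  = inj₁ (a , b)
    ... | inj₁ ok       | _             = 0 , ok
    ... | inj₂ _        | inj₁ ok       = 1 , ok
    ... | inj₂ (inj₁ a) | inj₂ (inj₁ b) = ⊥-elim (apart₀₁ d₁ δ₁≢0 a b)
    ... | inj₂ (inj₂ a) | inj₂ (inj₂ b) = ⊥-elim (apart₀₁ d₂ δ₂≢0 a b)
    ... | inj₂ (inj₁ a) | inj₂ (inj₂ b) = 2 , apart₀₂ d₁ δ₁≢0 a , apart₁₂ d₂ δ₂≢0 b
    ... | inj₂ (inj₂ a) | inj₂ (inj₁ b) = 2 , apart₁₂ d₁ δ₁≢0 b , apart₀₂ d₂ δ₂≢0 a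

-- Configurations, pulses and single firings

module Walk (p : ℕ) .{{_ : NonZero p}} (p≥3 : p ≥ 3) (2∤p : 2 ∤ p)
            (G : Hypergraph) (good : Hypergraph.Good G) where

  open Residue p
  open Odd p≥3 2∤p
  open Hypergraph G

  -- Configurations are handled as integer representatives, compared by _≋_.
  Conf : Set
  Conf = Vertex → ℤ

  infixl 6 _∔_
  infixl 7 _⊡_
  infix  4 _≋_ _↝_

  _∔_ : Conf → Conf → Conf
  (w ∔ q) u = w u + q u

  _⊡_ : ℤ → Conf → Conf
  (k ⊡ q) u = k * q u

  record _≋_ (w w′ : Conf) : Set where
    constructor mod
    field difference : ∀ u → Null (w u - w′ u)
  open _≋_

  ≡⇒≋ : ∀ {w w′} → (∀ u → w u ≡ w′ u) → w ≋ w′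
  ≡⇒≋ {w} {w′} eq = mod λ u → null-≡ (cong (_- w′ u) (sym (eq u))) (null-self (w′ u))

  ≋-sym : ∀ {w w′} → w ≋ w′ → w′ ≋ w
  ≋-sym {w} {w′} e = mod λ u → null-≡ (lemma (w u) (w′ u)) (null-neg (difference e u))
    where
    lemma : ∀ a b → - (a - b) ≡ b - a
    lemma = solve-∀

  ≋-trans : ∀ {w w′ w″} → w ≋ w′ → w′ ≋ w″ → w ≋ w″
  ≋-trans {w} {w′} {w″} e e′ = mod λ u → null-≡ (lemma (w u) (w′ u) (w″ u)) (null-+ (difference e u) (difference e′ u))
    where
    lemma : ∀ a b c → (a - b) + (b - c) ≡ a - c
    lemma = solve-∀

  ∔-cong : ∀ {w w′} q → w ≋ w′ → w ∔ q ≋ w′ ∔ q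
  ∔-cong {w} {w′} q e = mod λ u → null-≡ (lemma (w u) (w′ u) (q u)) (difference e u)
    where
    lemma : ∀ a b c → a - b ≡ a + c - (b + c)
    lemma = solve-∀

  state : Conf → State G p
  state w = tabulate (residue ∘ w)

  state-cong : ∀ {w w′} → w ≋ w′ → state w ≡ state w′
  state-cong {w} {w′} e = tabulate-cong (λ u → residue-cong {w u} {w′ u} (difference e u))

  -- A record, because the integer representatives cannot be recovered from the states that they
  -- induce.
  record _↝_ (w w′ : Conf) : Set where
    constructor reach
    field moves : Reachable G (state w) (state w′)
  open _↝_

  infixr 5 _▷_
  _▷_ : ∀ {w w′ w″} → w ↝ w′ → w′ ↝ w″ → w ↝ w″
  reach r ▷ reach s = reach (r ◅◅ s)

  ≋⇒↝ : ∀ {w w′} → w ≋ w′ → w ↝ w′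
  ≋⇒↝ {w} e = reach (subst (Reachable G (state w)) (state-cong e) ε)

  -- The vector that a move at `v` along `e` adds. Its entry at `v` is -1 even when `v` is not on
  -- `e`, so only the case `v ∈ edge e` is meaningful.
  pulse : Edge → Vertex → Conf
  pulse e v u with u ≟ v | u ∈? edge e
  ... | yes _ | _     = - 1ℤ
  ... | no _  | yes _ = 1ℤ
  ... | no _  | no _  = 0ℤ

  pulse-self : ∀ e v → pulse e v v ≡ - 1ℤ
  pulse-self e v with v ≟ v | v ∈? edge e
  ... | yes _  | _ = refl
  ... | no v≢v | _ = contradiction refl v≢v

  pulse-other : ∀ e v {u} → u ∈ edge e → u ≢ v → pulse e v u ≡ 1ℤ
  pulse-other e v {u} u∈e u≢v with u ≟ v | u ∈? edge e
  ... | yes u≡v | _      = contradiction u≡v u≢v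
  ... | no _    | yes _  = refl
  ... | no _    | no u∉e = contradiction u∈e u∉e

  pulse-outside : ∀ e v {u} → v ∈ edge e → u ∉ edge e → pulse e v u ≡ 0ℤ
  pulse-outside e v {u} v∈e u∉e with u ≟ v | u ∈? edge e
  ... | yes refl | _       = contradiction v∈e u∉e
  ... | no _     | yes u∈e = contradiction u∈e u∉e
  ... | no _     | no _    = refl

  fire : ∀ {e v w} → v ∈ edge e → ¬ Null (w v) → w ↝ w ∔ pulse e v
  fire {e} {v} {w} v∈e wv≢0 = reach (move ◅ ε)
    where
    at : ∀ u {c} → pulse e v u ≡ c → lookup (state (w ∔ pulse e v)) u ≡ lookup (state w) u ⊕ residue c
    at u {c} eq = begin
      lookup (state (w ∔ pulse e v)) u ≡⟨ lookup∘tabulate _ u ⟩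
      residue (w u + pulse e v u)      ≡⟨ cong (λ k → residue (w u + k)) eq ⟩
      residue (w u + c)                ≡⟨ ⊕-residue (w u) c ⟨
      residue (w u) ⊕ residue c        ≡⟨ cong (_⊕ residue c) (lookup∘tabulate _ u) ⟨
      lookup (state w) u ⊕ residue c   ∎
      where open ≡-Reasoning
    move : Move G (state w) (state (w ∔ pulse e v))
    move .Move.v = v
    move .Move.e = e
    move .Move.v∈e = v∈e
    move .Move.nonzero eq = wv≢0 (null-≡ (lemma (w v)) (residue-injective {w v} {0ℤ} (trans (sym (lookup∘tabulate _ v)) eq)))
      where
      lemma : ∀ a → a - 0ℤ ≡ a
      lemma = solve-∀
    move .Move.decrement = trans (at v (pulse-self e v)) (cong (lookup (state w) v ⊕_) (sym (⊝-residue 1ℤ)))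
    move .Move.increment u u∈e u≢v = at u (pulse-other e v u∈e u≢v)
    move .Move.unchanged u u∉e = trans (at u (pulse-outside e v v∈e u∉e))
      (trans (cong (_⊕ residue 0ℤ) (lookup∘tabulate (residue ∘ w) u))
      (trans (⊕-residue (w u) 0ℤ)
      (trans (cong residue (lemma (w u))) (sym (lookup∘tabulate _ u)))))
      where
      lemma : ∀ a → a + 0ℤ ≡ a
      lemma = solve-∀

  iterate : ∀ q n w → (∀ k → k ℕ.< n → w ∔ + k ⊡ q ↝ w ∔ + k ⊡ q ∔ q) → w ↝ w ∔ + n ⊡ q
  iterate q zero    w _ = ≋⇒↝ (≡⇒≋ (λ u → lemma (w u) (q u)))
    where
    lemma : ∀ a b → a ≡ a + 0ℤ * b
    lemma = solve-∀
  iterate q (suc n) w f = iterate q n w (λ k k<n → f k (ℕ.m<n⇒m<1+n k<n))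
      ▷ f n ℕ.≤-refl ▷ ≋⇒↝ (≡⇒≋ (λ u → lemma (w u) (q u) (+ n)))
    where
    lemma : ∀ a b n → a + n * b + b ≡ a + (1ℤ + n) * b
    lemma = solve-∀

  -- The natural number that stands for -1: after one addition of a vector, `p′` further additions
  -- cancel it modulo `p`.
  p′ : ℕ
  p′ = pred p

  null-suc-p′ : Null (1ℤ + + p′)
  null-suc-p′ = null-≡ (cong +_ (sym (ℕ.suc-pred p))) ∣-refl

  -- Firing blocked vertices

  ¬null-at : ∀ a {q c} → q ≡ c → ¬ Null (a + c) → ¬ Null (a + q)
  ¬null-at _ refl n = n

  third : ∀ e a b → ∃[ c ] (c ∈ edge e × c ≢ a × c ≢ b)
  third e = ∃-third (edge e) (proj₂ good e)

  nonempty : ∀ e → ∃[ x ] (x ∈ edge e)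
  nonempty e = inhabited (ℕ.≤-trans (ℕ.s≤s ℕ.z≤n) (proj₂ good e))

  pulse-pair : ∀ e {u x} → u ∈ edge e → u ≢ x → pulse e u u + pulse e x u ≡ 0ℤ
  pulse-pair e {u} {x} u∈e u≢x rewrite pulse-self e u | pulse-other e x u∈e u≢x = refl

  pulse-pair′ : ∀ e {u x} → x ∈ edge e → u ≢ x → pulse e u x + pulse e x x ≡ 0ℤ
  pulse-pair′ e {u} {x} x∈e u≢x rewrite pulse-self e x | pulse-other e u x∈e (≢-sym u≢x) = refl

  pulse-pair-other : ∀ e {u x v} → v ∈ edge e → v ≢ u → v ≢ x → pulse e u v + pulse e x v ≡ + 2
  pulse-pair-other e {u} {x} v∈e v≢u v≢x rewrite pulse-other e u v∈e v≢u | pulse-other e x v∈e v≢x = refl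

  -- If w u = -1, then u can fire p - 1 times in a row; this raises v to -1,
  -- so that v can fire, after which u fires once more.
  fire-blocked-by-drain : ∀ {e u v w} → u ∈ edge e → v ∈ edge e → u ≢ v →
    Null (w v) → Null (w u + 1ℤ) → w ↝ w ∔ pulse e v
  fire-blocked-by-drain {e} {u} {v} {w} u∈e v∈e u≢v wv≡0 wu≡-1 =
      iterate (pulse e u) p′ w (λ k k<p′ → fire u∈e (drainable k k<p′))
    ▷ fire v∈e v-raised
    ▷ fire u∈e u-positive
    ▷ ≋⇒↝ (mod λ x → null-≡ (lemma (w x) (pulse e u x) (pulse e v x) (+ p′)) (null-* (pulse e u x) null-suc-p′))
    where
    lemma : ∀ a b c n → b * (1ℤ + n) ≡ a + n * b + c + b - (a + c)
    lemma = solve-∀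

    -- After `k` firings the entry at `u` is -(1 + k), which is nonzero because 1 + k < p.
    drainable : ∀ k → k ℕ.< p′ → ¬ Null (w u + + k * pulse e u u)
    drainable k k<p′ n rewrite pulse-self e u =
      ¬null-< k (subst (suc k ℕ.<_) (ℕ.suc-pred p) (ℕ.s≤s k<p′)) (null-≡ (lemma₁ (w u) (+ k)) (null-- wu≡-1 n))
      where
      lemma₁ : ∀ a k → a + 1ℤ - (a + k * - 1ℤ) ≡ 1ℤ + k
      lemma₁ = solve-∀

    v-raised : ¬ Null (w v + + p′ * pulse e u v)
    v-raised n rewrite pulse-other e u v∈e (≢-sym u≢v) =
      ¬null-1 (null-≡ (lemma₁ (w v) (+ p′)) (null-- (null-+ wv≡0 null-suc-p′) n))
      where
      lemma₁ : ∀ a n → a + (1ℤ + n) - (a + n * 1ℤ) ≡ 1ℤ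
      lemma₁ = solve-∀

    -- The `p′` firings have brought `u` from -1 to 0, and the firing of `v` lifts it to 1.
    u-positive : ¬ Null (w u + + p′ * pulse e u u + pulse e v u)
    u-positive n rewrite pulse-self e u | pulse-other e v u∈e u≢v =
      ¬null-1 (null-≡ (lemma₁ (w u) (+ p′)) (null-+ (null-- n wu≡-1) null-suc-p′))
      where
      lemma₁ : ∀ a n → a + n * - 1ℤ + 1ℤ - (a + 1ℤ) + (1ℤ + n) ≡ 1ℤ
      lemma₁ = solve-∀

  fire-both : ∀ {e u x w} → u ∈ edge e → x ∈ edge e → u ≢ x →
    ¬ Null (w u) → ¬ Null (w x + 1ℤ) → w ↝ w ∔ (pulse e u ∔ pulse e x)
  fire-both {e} {u} {x} {w} u∈e x∈e u≢x wu≢0 wx≢-1 =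
      fire u∈e wu≢0
    ▷ fire x∈e (¬null-at (w x) (pulse-other e u x∈e (≢-sym u≢x)) wx≢-1)
    ▷ ≋⇒↝ (≡⇒≋ (λ y → +-assoc (w y) (pulse e u y) (pulse e x y)))

  successor-nonzero : ∀ a → Null a → ¬ Null (a + 1ℤ)
  successor-nonzero a a≡0 a+1≡0 = ¬null-1 (null-≡ (lemma a) (null-- a+1≡0 a≡0))
    where
    lemma : ∀ a → a + 1ℤ - a ≡ 1ℤ
    lemma = solve-∀

  -- Firing `u` before `x` fails only if w u = 0 or w x = -1. In either case the opposite order
  -- works, because the hypotheses forbid the same obstruction at both vertices.
  fire-pair : ∀ {e u x w} → u ∈ edge e → x ∈ edge e → u ≢ x →
    ¬ (Null (w u) × Null (w x)) → ¬ (Null (w u + 1ℤ) × Null (w x + 1ℤ)) →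
    w ↝ w ∔ (pulse e u ∔ pulse e x)
  fire-pair {e} {u} {x} {w} u∈e x∈e u≢x not-0 not--1 with null? (w u) | null? (w x + 1ℤ)
  ... | no wu≢0  | no wx≢-1 = fire-both u∈e x∈e u≢x wu≢0 wx≢-1
  ... | yes wu≡0 | _        = fire-both x∈e u∈e (≢-sym u≢x) (λ wx≡0 → not-0 (wu≡0 , wx≡0)) (successor-nonzero (w u) wu≡0)
      ▷ ≋⇒↝ (≡⇒≋ (λ y → cong (_+_ (w y)) (+-comm (pulse e x y) (pulse e u y))))
  ... | no _     | yes wx≡-1 = fire-both x∈e u∈e (≢-sym u≢x)
                                 (λ wx≡0 → successor-nonzero (w x) wx≡0 wx≡-1) (λ wu≡-1 → not--1 (wu≡-1 , wx≡-1))
      ▷ ≋⇒↝ (≡⇒≋ (λ y → cong (_+_ (w y)) (+-comm (pulse e x y) (pulse e u y))))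

  -- Firing u and x together leaves w u and w x alone and raises v by 2, so
  -- v can fire; p - 1 further rounds of u and x cancel the first one.
  fire-blocked-by-pair : ∀ {e u x v w} → u ∈ edge e → x ∈ edge e → v ∈ edge e →
    u ≢ x → v ≢ u → v ≢ x → Null (w v) →
    ¬ (Null (w u) × Null (w x)) → ¬ (Null (w u + 1ℤ) × Null (w x + 1ℤ)) →
    ¬ (Null (w u + + 2) × Null (w x + + 2)) →
    w ↝ w ∔ pulse e v
  fire-blocked-by-pair {e} {u} {x} {v} {w} u∈e x∈e v∈e u≢x v≢u v≢x wv≡0 not-0 not--1 not--2 =
      fire-pair u∈e x∈e u≢x not-0 not--1
    ▷ fire v∈e (¬null-at (w v) (pulse-pair-other e v∈e v≢u v≢x) (λ n → ¬null-2 (null-≡ (lemma₁ (w v)) (null-- n wv≡0))))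
    -- The firing of `v` has raised `u` and `x` by 1, so the conditions of `fire-pair` now amount to
    -- `not--1` and `not--2`.
    ▷ iterate q p′ (w ∔ q ∔ pulse e v) (λ k _ → fire-pair u∈e x∈e u≢x
        (λ (a , b) → not--1 (null-≡ (u-raised k) a , null-≡ (x-raised k) b))
        (λ (a , b) → not--2 ( null-≡ (trans (cong (_+ 1ℤ) (u-raised k)) (lemma₂ (w u))) a
                            , null-≡ (trans (cong (_+ 1ℤ) (x-raised k)) (lemma₂ (w x))) b)))
    ▷ ≋⇒↝ (mod λ y → null-≡ (lemma (w y) (q y) (pulse e v y) (+ p′)) (null-* (q y) null-suc-p′))
    where
    q : Conf
    q = pulse e u ∔ pulse e x
    lemma : ∀ a b c n → b * (1ℤ + n) ≡ a + b + c + n * b - (a + c)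
    lemma = solve-∀
    lemma₁ : ∀ a → a + + 2 - a ≡ + 2
    lemma₁ = solve-∀
    lemma₂ : ∀ a → a + 1ℤ + 1ℤ ≡ a + + 2
    lemma₂ = solve-∀
    lemma₃ : ∀ a k → a + 0ℤ + 1ℤ + k * 0ℤ ≡ a + 1ℤ
    lemma₃ = solve-∀
    u-raised : ∀ k → w u + q u + pulse e v u + + k * q u ≡ w u + 1ℤ
    u-raised k rewrite pulse-pair e u∈e u≢x | pulse-other e v u∈e (≢-sym v≢u) = lemma₃ (w u) (+ k)
    x-raised : ∀ k → w x + q x + pulse e v x + + k * q x ≡ w x + 1ℤ
    x-raised k rewrite pulse-pair′ e x∈e u≢x | pulse-other e v x∈e (≢-sym v≢x) = lemma₃ (w x) (+ k)

  -- The pair (u , x) serves unless it is constantly 0, -1 or -2.  The first case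
  -- is excluded by w u ≢ 0, the second is treated by draining u, and in the third
  -- the vertex y, where the target is not -1, is a partner with w y ≢ -2.
  fire-virtually : ∀ {e v u y w} → v ∈ edge e → u ∈ edge e → ¬ Null (w u) →
    y ∈ edge e → ¬ Null (w y + pulse e v y + 1ℤ) → w ↝ w ∔ pulse e v
  fire-virtually {e} {v} {u} {y} {w} v∈e u∈e wu≢0 y∈e target with null? (w v)
  ... | no wv≢0  = fire v∈e wv≢0
  ... | yes wv≡0 with null? (w u + 1ℤ) | null? (w u + + 2)
  ...   | yes wu≡-1 | _ = fire-blocked-by-drain u∈e v∈e u≢v wv≡0 wu≡-1
    where
    u≢v : u ≢ v
    u≢v refl = wu≢0 wv≡0
  ...   | no wu≢-1 | no wu≢-2 = let (x , x∈e , x≢u , x≢v) = third e u v in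
        fire-blocked-by-pair u∈e x∈e v∈e (≢-sym x≢u) (λ { refl → wu≢0 wv≡0 }) (≢-sym x≢v) wv≡0
          (λ (a , _) → wu≢0 a) (λ (a , _) → wu≢-1 a) (λ (a , _) → wu≢-2 a)
  ...   | no wu≢-1 | yes wu≡-2 =
        fire-blocked-by-pair u∈e y∈e v∈e (λ { refl → wy≢-2 wu≡-2 }) (λ { refl → wu≢0 wv≡0 }) (≢-sym y≢v) wv≡0
          (λ (a , _) → wu≢0 a) (λ (a , _) → wu≢-1 a) (λ (_ , b) → wy≢-2 b)
    where
    lemma₁ : ∀ a → a ≡ a + - 1ℤ + 1ℤ
    lemma₁ = solve-∀
    lemma₂ : ∀ a → a + + 2 ≡ a + 1ℤ + 1ℤ
    lemma₂ = solve-∀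
    y≢v : y ≢ v
    y≢v refl = target (null-≡ (trans (lemma₁ (w y)) (cong (λ c → w y + c + 1ℤ) (sym (pulse-self e y)))) wv≡0)
    wy≢-2 : ¬ Null (w y + + 2)
    wy≢-2 n = target (null-≡ (trans (lemma₂ (w y)) (cong (λ c → w y + c + 1ℤ) (sym (pulse-other e v y∈e y≢v)))) n)

  -- Configurations that are nonconstant on an edge

  record Mixed (e : Edge) (w : Conf) : Set where
    constructor mixed
    field
      {s t} : Vertex
      s∈e   : s ∈ edge e
      t∈e   : t ∈ edge e
      ws≢wt : ¬ Null (w s - w t)

  Mixed-cong : ∀ {e w w′} → w ≋ w′ → Mixed e w → Mixed e w′
  Mixed-cong {e} {w} {w′} (mod eq) (mixed {s} {t} s∈e t∈e ws≢wt) = mixed s∈e t∈e λ n →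
      ws≢wt (null-≡ (lemma (w s) (w t) (w′ s) (w′ t)) (null-- (null-+ n (eq s)) (eq t)))
    where
    lemma : ∀ a b c d → c - d + (a - c) - (b - d) ≡ a - b
    lemma = solve-∀

  -- Two distinct values cannot both be `c`. The relevant values are 0 before a firing and -1 after
  -- it.
  ∃-avoiding : ∀ {e w} → Mixed e w → ∀ c → ∃[ u ] (u ∈ edge e × ¬ Null (w u - c))
  ∃-avoiding {e} {w} (mixed {s} {t} s∈e t∈e ws≢wt) c with null? (w s - c)
  ... | no  ws≢c = s , s∈e , ws≢c
  ... | yes ws≡c = t , t∈e , λ wt≡c → ws≢wt (null-≡ (lemma (w s) (w t) c) (null-- ws≡c wt≡c))
    where
    lemma : ∀ a b c → a - c - (b - c) ≡ a - b
    lemma = solve-∀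

  fire-mixed : ∀ {e v w} → v ∈ edge e → Mixed e w → Mixed e (w ∔ pulse e v) → w ↝ w ∔ pulse e v
  fire-mixed {w = w} v∈e m m′ =
    let (u , u∈e , wu≢0)  = ∃-avoiding m 0ℤ
        (y , y∈e , w′y≢-1) = ∃-avoiding m′ (- 1ℤ)
    in fire-virtually v∈e u∈e (λ n → wu≢0 (null-≡ (sym (+-identityʳ (w u))) n)) y∈e w′y≢-1

  -- Connecting configurations

  Firings : Set₁
  Firings = Edge → Vertex → Set

  -- Sequences of firings from L that ignore the requirement w v ≢ 0.
  infix 4 _⊢_⇝_
  data _⊢_⇝_ (L : Firings) (w w′ : Conf) : Set where
    done : w ≋ w′ → L ⊢ w ⇝ w′
    step : ∀ {e v} → v ∈ edge e → L e v → L ⊢ w ∔ pulse e v ⇝ w′ → L ⊢ w ⇝ w′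

  ⇝-head : ∀ {L w w′ w″} → w ≋ w′ → L ⊢ w′ ⇝ w″ → L ⊢ w ⇝ w″
  ⇝-head eq (done eq′)           = done (≋-trans eq eq′)
  ⇝-head eq (step {e} {v} v∈e l r) = step v∈e l (⇝-head (∔-cong (pulse e v) eq) r)

  ⇝-trans : ∀ {L w w′ w″} → L ⊢ w ⇝ w′ → L ⊢ w′ ⇝ w″ → L ⊢ w ⇝ w″
  ⇝-trans (done eq)      s = ⇝-head eq s
  ⇝-trans (step v∈e l r) s = step v∈e l (⇝-trans r s)

  ⇝-≡ : ∀ {L w w′ w″} → L ⊢ w ⇝ w′ → (∀ u → w′ u ≡ w″ u) → L ⊢ w ⇝ w″
  ⇝-≡ r eq = ⇝-trans r (done (≡⇒≋ eq))

  ⇝-shift : ∀ {L w w′} q → L ⊢ w ⇝ w′ → L ⊢ w ∔ q ⇝ w′ ∔ q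
  ⇝-shift q (done eq) = done (∔-cong q eq)
  ⇝-shift {w = w} q (step {e} {v} v∈e l r) =
    step v∈e l (⇝-head (≡⇒≋ (λ u → lemma (w u) (q u) (pulse e v u))) (⇝-shift q r))
    where
    lemma : ∀ a b c → a + b + c ≡ a + c + b
    lemma = solve-∀

  ⇝-multiple : ∀ {L e v w} → v ∈ edge e → L e v → ∀ k → L ⊢ w ⇝ w ∔ + k ⊡ pulse e v
  ⇝-multiple {e = e} {v} {w} v∈e l zero = done (≡⇒≋ (λ u → lemma (w u) (pulse e v u)))
    where
    lemma : ∀ a b → a ≡ a + 0ℤ * b
    lemma = solve-∀
  ⇝-multiple {e = e} {v} {w} v∈e l (suc k) =
    step v∈e l (⇝-≡ (⇝-multiple v∈e l k) (λ u → lemma (w u) (pulse e v u) (+ k)))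
    where
    lemma : ∀ a b k → a + b + k * b ≡ a + (1ℤ + k) * b
    lemma = solve-∀

  -- Each step is undone by repeating its pulse `p′` more times.
  ⇝-sym : ∀ {L w w′} → L ⊢ w ⇝ w′ → L ⊢ w′ ⇝ w
  ⇝-sym (done eq) = done (≋-sym eq)
  ⇝-sym {w = w} (step {e} {v} v∈e l r) = ⇝-trans (⇝-sym r)
    (⇝-trans (⇝-multiple v∈e l p′)
      (done (mod λ u → null-≡ (lemma (w u) (pulse e v u) (+ p′)) (null-* (pulse e v u) null-suc-p′))))
    where
    lemma : ∀ a b n → b * (1ℤ + n) ≡ a + b + n * b - a
    lemma = solve-∀

  ⇝-mono : ∀ {L L′ : Firings} {w w′} → (∀ e v → L e v → L′ e v) → L ⊢ w ⇝ w′ → L′ ⊢ w ⇝ w′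
  ⇝-mono f (done eq)      = done eq
  ⇝-mono f (step v∈e l r) = step v∈e (f _ _ l) (⇝-mono f r)

  Connects : Firings → Edge → Set
  Connects L e = ∀ {w w′} → Mixed e w → Mixed e w′ → L ⊢ w ⇝ w′ → w ↝ w′

  single : Edge → Vertex → Firings
  single e a f v = f ≡ e × v ≡ a

  ⇝-single : ∀ {e a w w′} → single e a ⊢ w ⇝ w′ → ∃[ k ] (w ∔ + k ⊡ pulse e a ≋ w′)
  ⇝-single {e} {a} {w} (done eq) = 0 , ≋-trans (≡⇒≋ (λ u → lemma (w u) (pulse e a u))) eq
    where
    lemma : ∀ a b → a + 0ℤ * b ≡ a
    lemma = solve-∀
  ⇝-single {e} {a} {w} (step _ (refl , refl) r) = let (k , eq) = ⇝-single r in
    suc k , ≋-trans (≡⇒≋ (λ u → lemma (w u) (pulse e a u) (+ k))) eq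
    where
    lemma : ∀ a b k → a + (1ℤ + k) * b ≡ a + b + k * b
    lemma = solve-∀

  module _ {e a b x} (a∈e : a ∈ edge e) (b∈e : b ∈ edge e) (x∈e : x ∈ edge e)
           (b≢a : b ≢ a) (x≢a : x ≢ a) (x≢b : x ≢ b) where
    private
      q r : Conf
      q = pulse e a
      r = pulse e b

    -- `pulse e a` raises `b` and `x` equally, so their difference persists and every intermediate
    -- configuration is nonconstant on `e`.
    multiple-apart : ∀ {w} k → ¬ Null (w b - w x) → w ↝ w ∔ + k ⊡ q
    multiple-apart {w} k d = iterate q k w λ j _ →
      fire-mixed a∈e (mixed b∈e x∈e (λ n → d (null-≡ (lemma₁ j) n)))
                     (mixed b∈e x∈e (λ n → d (null-≡ (lemma₂ j) n)))
      where
      ring₁ : ∀ b x j → b + j * 1ℤ - (x + j * 1ℤ) ≡ b - x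
      ring₁ = solve-∀
      ring₂ : ∀ b x j → b + j * 1ℤ + 1ℤ - (x + j * 1ℤ + 1ℤ) ≡ b - x
      ring₂ = solve-∀
      lemma₁ : ∀ j → w b + + j * q b - (w x + + j * q x) ≡ w b - w x
      lemma₁ j rewrite pulse-other e a b∈e b≢a | pulse-other e a x∈e x≢a = ring₁ (w b) (w x) (+ j)
      lemma₂ : ∀ j → w b + + j * q b + q b - (w x + + j * q x + q x) ≡ w b - w x
      lemma₂ j rewrite pulse-other e a b∈e b≢a | pulse-other e a x∈e x≢a = ring₂ (w b) (w x) (+ j)

    -- When w b = w x, a multiple of pulse e a may pass through a constant
    -- state; a detour along pulse e b keeps b and x apart.
    multiple-mixed : ∀ {w} k → Mixed e w → Mixed e (w ∔ + k ⊡ q) → w ↝ w ∔ + k ⊡ q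
    multiple-mixed {w} k m m′ with null? (w b - w x)
    ... | no  d = multiple-apart k d
    ... | yes d = fire-mixed b∈e m (mixed b∈e x∈e d′)
        ▷ multiple-apart k d′
        ▷ iterate r p′ w₂ (λ j j<p′ → fire-mixed b∈e
            (mixed b∈e x∈e (λ n → odd-turn j j<p′ (null-≡ (shape₁ j) n))) (next j))
        ▷ ≋⇒↝ (mod λ u → null-≡ (turn (w u) (+ k * q u) (r u) (+ p′)) (null-* (r u) null-suc-p′))
      where
      w₂ : Conf
      w₂ = w ∔ r ∔ + k ⊡ q
      turn : ∀ a c b n → b * (1ℤ + n) ≡ a + b + c + n * b - (a + c)
      turn = solve-∀
      ring₀ : ∀ a b → b - a + (a + - 1ℤ - (b + 1ℤ)) ≡ - + 2
      ring₀ = solve-∀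
      ring₀′ : ∀ a b → - (a - b) ≡ b - a
      ring₀′ = solve-∀
      d′ : ¬ Null (w b + r b - (w x + r x))
      d′ n rewrite pulse-self e b | pulse-other e b x∈e x≢b =
        ¬null--2 (null-≡ (ring₀ (w b) (w x)) (null-+ (null-≡ (ring₀′ (w b) (w x)) (null-neg d)) n))
      ring₁ : ∀ b x k j → b + - 1ℤ + k * 1ℤ + j * - 1ℤ - (x + 1ℤ + k * 1ℤ + j * 1ℤ) ≡ b - x - ((1ℤ + j) + (1ℤ + j))
      ring₁ = solve-∀
      ring₂ : ∀ b x k j → b + - 1ℤ + k * 1ℤ + j * - 1ℤ + - 1ℤ - (x + 1ℤ + k * 1ℤ + j * 1ℤ + 1ℤ) ≡
              b - x - ((1ℤ + (1ℤ + j)) + (1ℤ + (1ℤ + j)))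
      ring₂ = solve-∀
      shape₁ : ∀ j → w₂ b + + j * r b - (w₂ x + + j * r x) ≡ w b - w x - (+ suc j + + suc j)
      shape₁ j rewrite pulse-self e b | pulse-other e b x∈e x≢b | pulse-other e a b∈e b≢a | pulse-other e a x∈e x≢a =
        ring₁ (w b) (w x) (+ k) (+ j)
      shape₂ : ∀ j → w₂ b + + j * r b + r b - (w₂ x + + j * r x + r x) ≡ w b - w x - (+ suc (suc j) + + suc (suc j))
      shape₂ j rewrite pulse-self e b | pulse-other e b x∈e x≢b | pulse-other e a b∈e b≢a | pulse-other e a x∈e x≢a =
        ring₂ (w b) (w x) (+ k) (+ j)
      cancel : ∀ a b → a - (a - b) ≡ b
      cancel = solve-∀
      -- After 1 + j firings of `b` in all, the difference between `b` and `x` is -2 (1 + j),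
      -- nonzero because `p` is odd and 1 + j < p.
      odd-turn : ∀ j → j ℕ.< p′ → ¬ Null (w b - w x - (+ suc j + + suc j))
      odd-turn j j<p′ n = ¬null-< j (subst (suc j ℕ.<_) (ℕ.suc-pred p) (ℕ.s≤s j<p′))
        (null-half (+ suc j) (null-≡ (cancel (w b - w x) (+ suc j + + suc j)) (null-- d n)))
      -- The difference -2 (2 + j) vanishes only when `p` divides 2 + j. Then the firings of `b`
      -- have cancelled and the target is reached, which is mixed by `m′`.
      next : ∀ j → Mixed e (w₂ ∔ + j ⊡ r ∔ r)
      next j with null? (+ suc (suc j))
      ... | no  n = mixed b∈e x∈e λ n′ → n (null-half (+ suc (suc j))
                      (null-≡ (cancel (w b - w x) (+ suc (suc j) + + suc (suc j))) (null-- d (null-≡ (shape₂ j) n′))))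
      ... | yes n = Mixed-cong (mod λ u → null-≡ (ring₃ (w u) (r u) (+ k * q u) (+ j)) (null-* (- r u) n)) m′
        where
        ring₃ : ∀ a r c j → - r * (1ℤ + (1ℤ + j)) ≡ a + c - (a + r + c + j * r + r)
        ring₃ = solve-∀

  connects-single : ∀ {e a} → a ∈ edge e → Connects (single e a) e
  connects-single {e} {a} a∈e m m′ r =
    let (b , b∈e , b≢a , _)   = third e a a
        (x , x∈e , x≢a , x≢b) = third e a b
        (k , eq)              = ⇝-single r
    in multiple-mixed a∈e b∈e x∈e b≢a x≢a x≢b k m (Mixed-cong (≋-sym eq) m′) ▷ ≋⇒↝ eq

  -- Perturbations and the enlargement of the set of pulses

  -- A detour `q` that makes adding `m` feasible: being mixed on `e` lets a set connecting `e` enter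
  -- and leave the detour, and being mixed on `f` lets a pulse on `f` be added there.
  record Perturbation (L : Firings) (e f : Edge) (m u : Conf) : Set where
    constructor perturbation
    field
      q         : Conf
      path      : L ⊢ u ⇝ u ∔ q
      e-before  : Mixed e (u ∔ q)
      f-before  : Mixed f (u ∔ q)
      e-after   : Mixed e (u ∔ q ∔ m)
      f-after   : Mixed f (u ∔ q ∔ m)

  infixl 5 _∪ᶠ_
  _∪ᶠ_ : Firings → Edge → Firings
  (L ∪ᶠ f) e v = L e v ⊎ e ≡ f

  -- Each pulse on `f` is added at a perturbed configuration by `fire-mixed`; `conn` takes care of
  -- all travel by pulses from `L` in between.
  extend : ∀ {L e f} → (∀ m u → Perturbation L e f m u) → Connects L e → Connects (L ∪ᶠ f) e
  extend {L} {e} {f} perturb conn m m′ r = go m (done (≡⇒≋ λ _ → refl)) m′ r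
    where
    -- `a` is the configuration actually reached and `u` the one prescribed so far. They differ by
    -- pulses from `L`, which are postponed until the next use of `conn`.
    go : ∀ {a u w′} → Mixed e a → L ⊢ a ⇝ u → Mixed e w′ → L ∪ᶠ f ⊢ u ⇝ w′ → a ↝ w′
    go m r m′ (done eq)                = conn m m′ (⇝-trans r (done eq))
    go m r m′ (step v∈e (inj₁ l) s)    = go m (⇝-trans r (step v∈e l (done (≡⇒≋ λ _ → refl)))) m′ s
    go {u = u} m r m′ (step {v = v} v∈f (inj₂ refl) s) =
      let perturbation q path eb fb ea fa = perturb (pulse f v) u in
      conn m eb (⇝-trans r path) ▷ fire-mixed v∈f fb fa ▷ go ea (⇝-sym (⇝-shift (pulse f v) path)) m′ s

  apart-self-other : ∀ e {x y} → y ∈ edge e → y ≢ x → ¬ Null (pulse e x x - pulse e x y)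
  apart-self-other e {x} {y} y∈e y≢x n rewrite pulse-self e x | pulse-other e x y∈e y≢x = ¬null--2 n

  apart-self-outside : ∀ e {x y} → x ∈ edge e → y ∉ edge e → ¬ Null (pulse e x x - pulse e x y)
  apart-self-outside e {x} {y} x∈e y∉e n rewrite pulse-self e x | pulse-outside e x x∈e y∉e = ¬null--1 n

  apart-self : ∀ e {x y} → x ∈ edge e → y ≢ x → ¬ Null (pulse e x x - pulse e x y)
  apart-self e {x} {y} x∈e y≢x = [ (λ y∈e → apart-self-other e y∈e y≢x) , apart-self-outside e x∈e ]′ (toSum (y ∈? edge e))

  -- Both differences are arithmetic progressions in `j` with nonzero step, so `avoid-two` supplies
  -- a common `j`.
  separate : ∀ (w w′ q : Conf) x y x′ y′ → ¬ Null (q x - q y) → ¬ Null (q x′ - q y′) →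
    ∃[ j ] (¬ Null ((w ∔ + j ⊡ q) x - (w ∔ + j ⊡ q) y) × ¬ Null ((w′ ∔ + j ⊡ q) x′ - (w′ ∔ + j ⊡ q) y′))
  separate w w′ q x y x′ y′ δ δ′ =
    let (j , n , n′) = avoid-two (w x - w y) _ (w′ x′ - w′ y′) _ δ δ′
    in j , (λ z → n (null-≡ (lemma (w x) (w y) (q x) (q y) (+ j)) z))
         , (λ z → n′ (null-≡ (lemma (w′ x′) (w′ y′) (q x′) (q y′) (+ j)) z))
    where
    lemma : ∀ a b c d j → a + j * c - (b + j * d) ≡ a - b + j * (c - d)
    lemma = solve-∀

  -- The pair `x`, `y` lies on both edges, so keeping it apart serves `e` and `f` at once. Only two
  -- conditions remain, one before and one after adding `m`.
  perturb-shared : ∀ {L e f x y} → x ∈ edge e → x ∈ edge f → y ∈ edge e → y ∈ edge f → y ≢ x → L e x →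
    ∀ m u → Perturbation L e f m u
  perturb-shared {L} {e} {f} {x} {y} x∈e x∈f y∈e y∈f y≢x l m u =
    let (j , before , after) = separate u (u ∔ m) (pulse e x) x y x y δ δ
        after′ = λ n → after (null-≡ (lemma (u x) (u y) (m x) (m y) (+ j * pulse e x x) (+ j * pulse e x y)) n)
    in perturbation (+ j ⊡ pulse e x) (⇝-multiple x∈e l j)
         (mixed x∈e y∈e before) (mixed x∈f y∈f before) (mixed x∈e y∈e after′) (mixed x∈f y∈f after′)
    where
    δ = apart-self-other e y∈e y≢x
    lemma : ∀ a b c d s t → a + s + c - (b + t + d) ≡ a + c + s - (b + d + t)
    lemma = solve-∀

  -- Multiples of pulse e x separate x from x′ on f; then multiples of
  -- pulse e x ∔ pulse e y separate x from z on e without touching x and x′.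
  perturb-touching : ∀ {L e f x x′} → x ∈ edge e → x ∈ edge f → x′ ∈ edge f → x′ ∉ edge e → (∀ v → L e v) →
    ∀ m u → Perturbation L e f m u
  perturb-touching {L} {e} {f} {x} {x′} x∈e x∈f x′∈f x′∉e full m u =
    let (y , y∈e , y≢x , _)   = third e x x
        (z , z∈e , z≢x , z≢y) = third e x y
    in at y z y∈e y≢x z∈e z≢x z≢y
    where
    module _ (y z : Vertex) (y∈e : y ∈ edge e) (y≢x : y ≢ x) (z∈e : z ∈ edge e) (z≢x : z ≢ x) (z≢y : z ≢ y) where
      q₁ q₂ : Conf
      q₁ = pulse e x
      q₂ = pulse e x ∔ pulse e y

      q₂x≡0 : q₂ x ≡ 0ℤ
      q₂x≡0 = pulse-pair e x∈e (≢-sym y≢x)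

      q₂x′≡0 : q₂ x′ ≡ 0ℤ
      q₂x′≡0 = cong₂ _+_ (pulse-outside e x x∈e x′∉e) (pulse-outside e y y∈e x′∉e)

      q₂-apart : ¬ Null (q₂ x - q₂ z)
      q₂-apart n = ¬null--2 (null-≡ (cong₂ _-_ q₂x≡0 (pulse-pair-other e z∈e z≢x z≢y)) n)

      module _ (j i : ℕ) where
        q : Conf
        q = + j ⊡ q₁ ∔ + i ⊡ q₂

        path : L ⊢ u ⇝ u ∔ q
        path = ⇝-≡ (⇝-trans (⇝-multiple x∈e (full x) j) (⇝-trans (⇝-multiple x∈e (full x) i) (⇝-multiple y∈e (full y) i)))
          (λ v → ring (u v) (+ j * pulse e x v) (+ i) (pulse e x v) (pulse e y v))
          where
          ring : ∀ a b i c d → a + b + i * c + i * d ≡ a + (b + i * (c + d))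
          ring = solve-∀

        unmoved : ∀ w → (w ∔ q) x - (w ∔ q) x′ ≡ (w ∔ + j ⊡ q₁) x - (w ∔ + j ⊡ q₁) x′
        unmoved w = trans (cong₂ (λ a b → w x + (+ j * q₁ x + + i * a) - (w x′ + (+ j * q₁ x′ + + i * b))) q₂x≡0 q₂x′≡0)
          (ring (w x) (w x′) (+ j * q₁ x) (+ j * q₁ x′) (+ i))
          where
          ring : ∀ a b c d i → a + (c + i * 0ℤ) - (b + (d + i * 0ℤ)) ≡ a + c - (b + d)
          ring = solve-∀

      swap : ∀ (w m q : Conf) s t → (w ∔ q ∔ m) s - (w ∔ q ∔ m) t ≡ (w ∔ m ∔ q) s - (w ∔ m ∔ q) t
      swap w m q s t = ring (w s) (w t) (m s) (m t) (q s) (q t)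
        where
        ring : ∀ a b m n c d → a + c + m - (b + d + n) ≡ a + m + c - (b + n + d)
        ring = solve-∀

      assoc : ∀ (w q q′ : Conf) s t → (w ∔ (q ∔ q′)) s - (w ∔ (q ∔ q′)) t ≡ (w ∔ q ∔ q′) s - (w ∔ q ∔ q′) t
      assoc w q q′ s t = ring (w s) (w t) (q s) (q t) (q′ s) (q′ t)
        where
        ring : ∀ a b c d m n → a + (c + m) - (b + (d + n)) ≡ a + c + m - (b + d + n)
        ring = solve-∀

      at : Perturbation L e f m u
      at =
        let (j , f₁ , f₂) = separate u (u ∔ m) q₁ x x′ x x′
                              (apart-self-outside e x∈e x′∉e) (apart-self-outside e x∈e x′∉e)
            (i , e₁ , e₂) = separate (u ∔ + j ⊡ q₁) (u ∔ m ∔ + j ⊡ q₁) q₂ x z x z q₂-apart q₂-apart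
        in perturbation (q j i) (path j i)
             (mixed x∈e z∈e λ n → e₁ (null-≡ (assoc u (+ j ⊡ q₁) (+ i ⊡ q₂) x z) n))
             (mixed x∈f x′∈f λ n → f₁ (null-≡ (unmoved j i u) n))
             (mixed x∈e z∈e λ n → e₂ (null-≡ (trans (swap u m (q j i) x z) (assoc (u ∔ m) (+ j ⊡ q₁) (+ i ⊡ q₂) x z)) n))
             (mixed x∈f x′∈f λ n → f₂ (null-≡ (trans (swap u m (q j i) x x′) (unmoved j i (u ∔ m))) n))

  perturb-adjacent : ∀ {L e f x} → x ∈ edge e → x ∈ edge f → (∀ v → L e v) → ∀ m u → Perturbation L e f m u
  perturb-adjacent {L} {e} {f} {x} x∈e x∈f full with third f x x
  ... | x′ , x′∈f , x′≢x , _ with x′ ∈? edge e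
  ... | yes x′∈e = perturb-shared x∈e x∈f x′∈e x′∈f x′≢x (full x)
  ... | no  x′∉e = perturb-touching x∈e x∈f x′∈f x′∉e full

  -- The case f = e of `extend`: an edge shares two vertices with itself, so the pulse at the one
  -- vertex `a` provides all perturbations.
  connects-edge : ∀ e → Connects (λ f _ → f ≡ e) e
  connects-edge e m m′ r =
    let (a , a∈e , _)       = third e (Mixed.s m) (Mixed.s m)
        (b , b∈e , b≢a , _) = third e a a
    in extend (perturb-shared a∈e a∈e b∈e b∈e b≢a (refl , refl)) (connects-single a∈e) m m′ (⇝-mono (λ _ _ → inj₂) r)

  -- Multiples of `pulse f x` make both ends nonconstant on `e` as well as on `f`. Pulses on `f`
  -- lead to and from these shifted ends, and `conn` joins them.
  transfer : ∀ {L e f x} → x ∈ edge e → x ∈ edge f → (∀ v → L f v) → Connects L e → Connects L f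
  transfer {L} {e} {f} {x} x∈e x∈f full conn {w} {w′} m m′ r =
    let (y , y∈e , y≢x , _) = third e x x
        (z , z∈f , z≢x , _) = third f x x
        y-apart = apart-self f x∈f y≢x
        z-apart = apart-self f x∈f z≢x
        (j  , me  , mf ) = separate w  w  (pulse f x) x y x z y-apart z-apart
        (j′ , me′ , mf′) = separate w′ w′ (pulse f x) x y x z y-apart z-apart
    in connects-edge f m (mixed x∈f z∈f mf) (⇝-multiple x∈f refl j)
     ▷ conn (mixed x∈e y∈e me) (mixed x∈e y∈e me′)
         (⇝-trans (⇝-sym (⇝-multiple x∈f (full x) j)) (⇝-trans r (⇝-multiple x∈f (full x) j′)))
     ▷ connects-edge f (mixed x∈f z∈f mf′) m′ (⇝-sym (⇝-multiple x∈f refl j′))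

  -- Walking through the hypergraph

  grow : ∀ {L e f x} → x ∈ edge e → x ∈ edge f → (∀ v → L e v) → Connects L e → Connects (L ∪ᶠ f) f
  grow x∈e x∈f full conn = transfer x∈e x∈f (λ _ → inj₂ refl) (extend (perturb-adjacent x∈e x∈f full) conn)

  -- Induction on the path: each of its edges joins the set and becomes the connected edge, sharing
  -- a vertex with the next one. Nothing is lost on the way.
  grow-along : ∀ {x y f} → Star Adjacent x y → y ∈ edge f → ∀ {L e} → x ∈ edge e → (∀ v → L e v) → Connects L e →
    ∃[ L′ ] ((∀ g v → L g v → L′ g v) × (∀ v → L′ f v) × Connects L′ f)
  grow-along {f = f} ε y∈f {L} x∈e full conn = L ∪ᶠ f , (λ _ _ → inj₁) , (λ _ → inj₂ refl) , grow x∈e y∈f full conn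
  grow-along ((g , x∈g , x′∈g) ◅ path) y∈f x∈e full conn =
    let (L′ , L⊆L′ , full′ , conn′) = grow-along path y∈f x′∈g (λ _ → inj₂ refl) (grow x∈e x∈g full conn)
    in L′ , (λ h v l → L⊆L′ h v (inj₁ l)) , full′ , conn′

  -- The walk visits the edges of `fs` one after another; connectedness supplies the path from the
  -- current edge to the next.
  grow-over : Edge → ∀ fs → ∃[ L ] ∃[ e ] (All (λ f → ∀ v → L f v) fs × (∀ v → L e v) × Connects L e)
  grow-over e₀ []       = (λ f _ → f ≡ e₀) , e₀ , [] , (λ _ → refl) , connects-edge e₀
  grow-over e₀ (f ∷ fs) with grow-over e₀ fs
  ... | L , e , fulls , full , conn with nonempty e | nonempty f
  ... | x , x∈e | y , y∈f =
    let (L′ , L⊆L′ , full′ , conn′) = grow-along (proj₁ good x y) y∈f x∈e full conn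
    in L′ , f , full′ ∷ All.map (λ l v → L⊆L′ _ v (l v)) fulls , full′ , conn′

  Everything : Firings
  Everything _ _ = ⊤

  connects-everything : ∀ (e₀ : Edge) → ∃[ e ] Connects Everything e
  connects-everything e₀ =
    let (L , e , fulls , _ , conn) = grow-over e₀ (allFin size)
    in e , λ m m′ r → conn m m′ (⇝-mono (λ f v _ → All.lookup fulls (∈-allFin f) v) r)

  -- Reaching and leaving the nonconstant configurations

  ⇝-refl : ∀ {L w} → L ⊢ w ⇝ w
  ⇝-refl = done (≡⇒≋ λ _ → refl)

  -- A nonzero entry is carried along the path: if the next vertex has 0, firing the current one
  -- raises it to 1. On `e`, if `u` and `y` agree, firing `u` changes their difference to -2.
  leave-zero : ∀ {e x u} → Star Adjacent u x → x ∈ edge e → ∀ {w} → ¬ Null (w u) →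
    ∃[ h ] (w ↝ h × Everything ⊢ w ⇝ h × Mixed e h)
  leave-zero {e} {u = u} ε u∈e {w} wu≢0 with third e u u
  ... | y , y∈e , y≢u , _ with null? (w u - w y)
  ... | no  d = w , reach ε , ⇝-refl , mixed u∈e y∈e d
  ... | yes d = w ∔ pulse e u , fire u∈e wu≢0 , step u∈e tt ⇝-refl , mixed u∈e y∈e d′
    where
    ring : ∀ a b c d → a + c - (b + d) - (a - b) ≡ c - d
    ring = solve-∀
    d′ : ¬ Null (w u + pulse e u u - (w y + pulse e u y))
    d′ n = apart-self-other e y∈e y≢u (null-≡ (ring (w u) (w y) (pulse e u u) (pulse e u y)) (null-- n d))
  leave-zero {u = u} (_◅_ {j = u′} (f , u∈f , u′∈f) path) x∈e {w} wu≢0 with null? (w u′)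
  ... | no  wu′≢0 = leave-zero path x∈e wu′≢0
  ... | yes wu′≡0 =
    let (h , r , s , m) = leave-zero path x∈e {w ∔ pulse f u} raised
    in h , fire u∈f wu≢0 ▷ r , step u∈f tt s , m
    where
    raised : ¬ Null (w u′ + pulse f u u′)
    raised = ¬null-at (w u′) (pulse-other f u u′∈f (λ { refl → wu≢0 wu′≡0 })) (successor-nonzero (w u′) wu′≡0)

  unfire : Edge → Vertex → Conf → Conf
  unfire e v w = w ∔ - 1ℤ ⊡ pulse e v

  unfire-fire : ∀ e v w → unfire e v w ∔ pulse e v ≋ w
  unfire-fire e v w = ≡⇒≋ (λ u → ring (w u) (pulse e v u))
    where
    ring : ∀ a b → a + - 1ℤ * b + b ≡ a
    ring = solve-∀

  -- Before the firing `v` has the entry w v + 1, so for the reversed walk -1 is the blocked value.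
  unfire-↝ : ∀ {e v w} → v ∈ edge e → ¬ Null (w v + 1ℤ) → unfire e v w ↝ w
  unfire-↝ {e} {v} {w} v∈e wv≢-1 =
    fire v∈e (¬null-at (w v) (cong (- 1ℤ *_) (pulse-self e v)) wv≢-1) ▷ ≋⇒↝ (unfire-fire e v w)

  -- The time reversal of `leave-zero`, with -1 in the place of 0: undoing a firing lowers a
  -- neighbour from -1 to -2.
  enter-from-mixed : ∀ {e x u} → Star Adjacent u x → x ∈ edge e → ∀ {w} → ¬ Null (w u + 1ℤ) →
    ∃[ h ] (h ↝ w × Everything ⊢ h ⇝ w × Mixed e h)
  enter-from-mixed {e} {u = u} ε u∈e {w} wu≢-1 with third e u u
  ... | y , y∈e , y≢u , _ with null? (w u - w y)
  ... | no  d = w , reach ε , ⇝-refl , mixed u∈e y∈e d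
  ... | yes d = unfire e u w , unfire-↝ u∈e wu≢-1 , step u∈e tt (done (unfire-fire e u w)) , mixed u∈e y∈e d′
    where
    ring : ∀ a b c d → a - b - (a + - 1ℤ * c - (b + - 1ℤ * d)) ≡ c - d
    ring = solve-∀
    d′ : ¬ Null (unfire e u w u - unfire e u w y)
    d′ n = apart-self-other e y∈e y≢u (null-≡ (ring (w u) (w y) (pulse e u u) (pulse e u y)) (null-- d n))
  enter-from-mixed {u = u} (_◅_ {j = u′} (f , u∈f , u′∈f) path) x∈e {w} wu≢-1 with null? (w u′ + 1ℤ)
  ... | no  wu′≢-1 = enter-from-mixed path x∈e wu′≢-1
  ... | yes wu′≡-1 =
    let (h , r , s , m) = enter-from-mixed path x∈e {unfire f u w} lowered
    in h , r ▷ unfire-↝ u∈f wu≢-1 , ⇝-trans s (step u∈f tt (done (unfire-fire f u w))) , m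
    where
    ring : ∀ a → a + 1ℤ - (a + - 1ℤ * 1ℤ + 1ℤ) ≡ 1ℤ
    ring = solve-∀
    lowered : ¬ Null (unfire f u w u′ + 1ℤ)
    lowered n = ¬null-1 (null-≡ (ring (w u′)) (null-- wu′≡-1
      (null-≡ (cong (λ c → w u′ + - 1ℤ * c + 1ℤ) (pulse-other f u u′∈f (λ { refl → wu≢-1 wu′≡-1 }))) n)))

  reach-everything : ∀ {w w′ u u′} → Edge → ¬ Null (w u) → ¬ Null (w′ u′ + 1ℤ) → Everything ⊢ w ⇝ w′ → w ↝ w′
  reach-everything {u = u} {u′} e₀ wu≢0 w′u′≢-1 r with connects-everything e₀
  ... | e , conn with nonempty e
  ... | x , x∈e =
    let (h  , w↝h   , w⇝h   , m)  = leave-zero (proj₁ good u x) x∈e wu≢0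
        (h′ , h′↝w′ , h′⇝w′ , m′) = enter-from-mixed (proj₁ good u′ x) x∈e w′u′≢-1
    -- The prescribed pulses are corrected by those spent on leaving `w` and on entering `w′`.
    in w↝h ▷ conn m m′ (⇝-trans (⇝-sym w⇝h) (⇝-trans r (⇝-sym h′⇝w′))) ▷ h′↝w′

  -- The linear system

  residue-∑ : ∀ {k} {F : Fin k → ℤ/ p} {f : Fin k → ℤ} → (∀ i → F i ≡ residue (f i)) → ∑ F ≡ residue (sum f)
  residue-∑ {zero}  eq = refl
  residue-∑ {suc k} {f = f} eq = trans (cong₂ _⊕_ (eq zero) (residue-∑ (eq ∘ suc))) (⊕-residue (f zero) (sum (f ∘ suc)))

  residue-gate : ∀ {P : Set} (d : Dec P) {F : P → ℤ/ p} {a} → (∀ x → F x ≡ residue a) → ([ d ]· F) ≡ residue (gate d a)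
  residue-gate (yes x) eq = eq x
  residue-gate (no _)  eq = refl

  displacement : (Edge → Vertex → ℤ) → Conf
  displacement X u = sum λ e → sum λ v → gate (v ∈? edge e) (X e v * pulse e v u)

  gain loss : (Edge → Vertex → ℤ) → Conf
  gain X v = sum λ e → gate (v ∈? edge e) (sum λ u → gate ((u ∈? edge e) ×-dec ¬? (u ≟ v)) (X e u))
  loss X v = sum λ e → gate (v ∈? edge e) (X e v)

  -- On an edge through `v`, the summand u = v is the only negative one; adding `X e v` cancels it
  -- and leaves the gain.
  displacement-edge : ∀ (X : Edge → Vertex → ℤ) e v (v∈?e : Dec (v ∈ edge e)) →
    sum (λ u → gate (u ∈? edge e) (X e u * pulse e u v)) + gate v∈?e (X e v)
      ≡ gate v∈?e (sum λ u → gate ((u ∈? edge e) ×-dec ¬? (u ≟ v)) (X e u))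
  displacement-edge X e v (no v∉e) = trans (+-identityʳ _) (sum-zero _ λ u → off-edge u (u ∈? edge e))
    where
    off-edge : ∀ u (d : Dec (u ∈ edge e)) → gate d (X e u * pulse e u v) ≡ 0ℤ
    off-edge u (no _)    = refl
    off-edge u (yes u∈e) = trans (cong (X e u *_) (pulse-outside e u u∈e v∉e)) (*-zeroʳ (X e u))
  displacement-edge X e v (yes v∈e) = begin
    -- `X e v` is spread out as a sum supported at `v`, so that the two sums combine termwise.
    sum f + X e v                     ≡⟨ cong (_+_ (sum f)) (trans
                                           (sym (gate-yes (v ≟ v) refl)) (sym (sum-single s v (λ u u≢v → gate-no (u ≟ v) u≢v)))) ⟩
    sum f + sum s                     ≡⟨ ∑-distrib-+ f s ⟨
    sum (λ u → f u + s u)             ≡⟨ sum-cong-≗ (λ u → on-edge u (u ∈? edge e) (u ≟ v)) ⟩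
    sum (λ u → gate ((u ∈? edge e) ×-dec ¬? (u ≟ v)) (X e u)) ∎
    where
    open ≡-Reasoning
    f s : Vertex → ℤ
    f u = gate (u ∈? edge e) (X e u * pulse e u v)
    s u = gate (u ≟ v) (X e v)
    ring₁ : ∀ a → a * - 1ℤ + a ≡ 0ℤ
    ring₁ = solve-∀
    ring₂ : ∀ a → a * 1ℤ + 0ℤ ≡ a
    ring₂ = solve-∀
    on-edge : ∀ u (d : Dec (u ∈ edge e)) (d′ : Dec (u ≡ v)) →
      gate d (X e u * pulse e u v) + gate d′ (X e v) ≡ gate (d ×-dec ¬? d′) (X e u)
    on-edge u (yes _)  (yes refl) = trans (cong (λ c → X e u * c + X e u) (pulse-self e u)) (ring₁ (X e u))
    on-edge u (yes _)  (no u≢v)   = trans (cong (λ c → X e u * c + 0ℤ) (pulse-other e u v∈e (≢-sym u≢v))) (ring₂ (X e u))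
    on-edge u (no u∉e) (yes refl) = contradiction v∈e u∉e
    on-edge u (no _)   (no _)     = refl

  -- This identifies the left-hand side of the system with a combination of pulses: the unknown at
  -- `e` and `v` counts the firings of `v` along `e`.
  gain-loss : ∀ X v → gain X v - loss X v ≡ displacement X v
  gain-loss X v = trans (cong (_- loss X v) (sym
      (trans (sym (∑-distrib-+ f g)) (sum-cong-≗ (λ e → displacement-edge X e v (v ∈? edge e))))))
    (ring (displacement X v) (loss X v))
    where
    f g : Edge → ℤ
    f e = sum λ u → gate (u ∈? edge e) (X e u * pulse e u v)
    g e = gate (v ∈? edge e) (X e v)
    ring : ∀ a b → a + b - b ≡ a
    ring = solve-∀

  lift : State G p → Conf
  lift w v = + toℕ (lookup w v)

  -- Stated for any integer lift `Y` of `X`, since one direction of the theorem starts from integer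
  -- counts and the other from the unknowns.
  SolvesH⇔ : ∀ (w₁ w₂ : State G p) (X : Unknowns G p) Y → (∀ e v v∈e → X e v v∈e ≡ residue (Y e v)) →
    SolvesH G w₁ w₂ X ⇔ (lift w₁ ∔ displacement Y ≋ lift w₂)
  SolvesH⇔ w₁ w₂ X Y X≡Y = mk⇔
    (λ solves → mod λ v → null-≡ (ring (lift w₁ v) (lift w₂ v) (displacement Y v))
       (residue-injective {displacement Y v} (trans (sym (left v)) (trans (solves v) (right v)))))
    (λ (mod eq) v → trans (left v) (trans
       (residue-cong {displacement Y v} {lift w₂ v - lift w₁ v}
         (null-≡ (sym (ring (lift w₁ v) (lift w₂ v) (displacement Y v))) (eq v)))
       (sym (right v))))
    where
    ring : ∀ a b d → d - (b - a) ≡ a + d - b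
    ring = solve-∀
    right : ∀ v → lookup w₂ v ⊖ lookup w₁ v ≡ residue (lift w₂ v - lift w₁ v)
    right v = trans (sym (cong₂ _⊖_ (residue-toℕ (lookup w₂ v)) (residue-toℕ (lookup w₁ v))))
                (⊖-residue (lift w₂ v) (lift w₁ v))
    left : ∀ v →
         ∑ (λ e → [ v ∈? edge e ]· λ _ →
           ∑ (λ u → [ (u ∈? edge e) ×-dec ¬? (u ≟ v) ]· λ (u∈e , _) → X e u u∈e))
       ⊖ ∑ (λ e → [ v ∈? edge e ]· λ v∈e → X e v v∈e)
       ≡ residue (displacement Y v)
    left v = trans (cong₂ _⊖_
        (residue-∑ λ e → residue-gate (v ∈? edge e) λ _ →
           residue-∑ λ u → residue-gate ((u ∈? edge e) ×-dec ¬? (u ≟ v)) λ (u∈e , _) → X≡Y e u u∈e)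
        (residue-∑ λ e → residue-gate (v ∈? edge e) λ v∈e → X≡Y e v v∈e))
      (trans (⊖-residue (gain Y v) (loss Y v)) (cong residue (gain-loss Y v)))

  ⇝-sum : ∀ {L k} (f : Fin k → Conf) → (∀ i w → L ⊢ w ⇝ w ∔ f i) → ∀ w → L ⊢ w ⇝ w ∔ (λ u → sum λ i → f i u)
  ⇝-sum {k = zero}  f path w = done (≡⇒≋ λ u → sym (+-identityʳ (w u)))
  ⇝-sum {k = suc k} f path w = ⇝-≡ (⇝-trans (path zero w) (⇝-sum (f ∘ suc) (path ∘ suc) (w ∔ f zero)))
    (λ u → ring (w u) (f zero u) (sum λ i → f (suc i) u))
    where
    ring : ∀ a b c → a + b + c ≡ a + (b + c)
    ring = solve-∀

  -- The coefficients are natural numbers because they are numbers of firings.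
  ⇝-displacement : ∀ (N : Edge → Vertex → ℕ) w → Everything ⊢ w ⇝ w ∔ displacement (λ e v → + N e v)
  ⇝-displacement N = ⇝-sum _ λ e → ⇝-sum _ λ v w → gated e v w (v ∈? edge e)
    where
    gated : ∀ e v w (d : Dec (v ∈ edge e)) → Everything ⊢ w ⇝ w ∔ (λ u → gate d (+ N e v * pulse e v u))
    gated e v w (yes v∈e) = ⇝-multiple v∈e tt (N e v)
    gated e v w (no _)    = done (≡⇒≋ λ u → sym (+-identityʳ (w u)))

  counts : Unknowns G p → Edge → Vertex → ℕ
  counts X e v with v ∈? edge e
  ... | yes v∈e = toℕ (X e v v∈e)
  -- An arbitrary default: `displacement` discards the values off the edge.
  ... | no _    = 0

  counts-residue : ∀ X e v v∈e → X e v v∈e ≡ residue (+ counts X e v)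
  counts-residue X e v v∈e with v ∈? edge e
  -- A solution takes the membership proof as an argument; any two such proofs are equal.
  ... | yes v∈e′ = trans (cong (X e v) ([]=-irrelevant v∈e v∈e′)) (sym (residue-toℕ (X e v v∈e′)))
  ... | no v∉e   = contradiction v∈e v∉e

  indicator : Edge → Vertex → Edge → Vertex → ℤ
  indicator e v f u = gate (f ≟ e) (gate (u ≟ v) 1ℤ)

  displacement-indicator : ∀ {e v} → v ∈ edge e → ∀ u → displacement (indicator e v) u ≡ pulse e v u
  displacement-indicator {e} {v} v∈e u = trans (sum-single _ e other-edge) (trans (sum-single _ v other-vertex)
      (trans (gate-yes (v ∈? edge e) v∈e)
      (trans (cong (_* pulse e v u) (trans (gate-yes (e ≟ e) refl) (gate-yes (v ≟ v) refl))) (ring₁ (pulse e v u)))))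
    where
    ring₁ : ∀ a → 1ℤ * a ≡ a
    ring₁ = solve-∀
    gate-vanish : ∀ {P : Set} (d : Dec P) a c → a ≡ 0ℤ → gate d (a * c) ≡ 0ℤ
    gate-vanish d _ c refl = gate-0 d
    other-edge : ∀ f → f ≢ e → sum (λ t → gate (t ∈? edge f) (indicator e v f t * pulse f t u)) ≡ 0ℤ
    other-edge f f≢e = sum-zero _ λ t → gate-vanish (t ∈? edge f) _ (pulse f t u) (gate-no (f ≟ e) f≢e)
    other-vertex : ∀ t → t ≢ v → gate (t ∈? edge e) (indicator e v e t * pulse e t u) ≡ 0ℤ
    other-vertex t t≢v = gate-vanish (t ∈? edge e) _ (pulse e t u)
      (trans (gate-yes (e ≟ e) refl) (gate-no (t ≟ v) t≢v))

  displacement-+ : ∀ (X Y : Edge → Vertex → ℤ) u → displacement (λ e v → X e v + Y e v) u ≡ displacement X u + displacement Y u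
  displacement-+ X Y u = trans
      (sum-cong-≗ λ e → trans (sum-cong-≗ λ v → gate-+ (v ∈? edge e) (X e v) (Y e v) (pulse e v u))
                              (∑-distrib-+ (term X e) (term Y e)))
      (∑-distrib-+ (λ e → sum (term X e)) (λ e → sum (term Y e)))
    where
    term : (Edge → Vertex → ℤ) → Edge → Vertex → ℤ
    term X e v = gate (v ∈? edge e) (X e v * pulse e v u)
    ring : ∀ a b c → (a + b) * c ≡ a * c + b * c
    ring = solve-∀
    gate-+ : ∀ {P : Set} (d : Dec P) a b c → gate d ((a + b) * c) ≡ gate d (a * c) + gate d (b * c)
    gate-+ (yes _) = ring
    gate-+ (no _)  a b c = refl

  move-pulse : ∀ {w w′} (m : Move G w w′) → lift w ∔ pulse (Move.e m) (Move.v m) ≋ lift w′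
  move-pulse {w} {w′} m = mod at
    where
    open Move m
    shift : ∀ u c {x} → lookup w u ⊕ residue c ≡ x → lookup w′ u ≡ x → pulse e v u ≡ c →
      Null (lift w u + pulse e v u - lift w′ u)
    shift u c {x} eq eq′ refl = residue-injective {lift w u + c} {lift w′ u} (begin
      residue (lift w u + c)             ≡⟨ ⊕-residue (lift w u) c ⟨
      residue (lift w u) ⊕ residue c     ≡⟨ cong (_⊕ residue c) (residue-toℕ (lookup w u)) ⟩
      lookup w u ⊕ residue c             ≡⟨ eq ⟩
      x                                  ≡⟨ eq′ ⟨
      lookup w′ u                        ≡⟨ residue-toℕ (lookup w′ u) ⟨
      residue (lift w′ u)                ∎)
      where open ≡-Reasoning
    at′ : ∀ u → Dec (u ≡ v) → Dec (u ∈ edge e) → Null (lift w u + pulse e v u - lift w′ u)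
    at′ u (yes refl) _        = shift u (- 1ℤ) (cong (lookup w u ⊕_) (sym (⊝-residue 1ℤ))) decrement (pulse-self e v)
    at′ u (no u≢v) (yes u∈e)  = shift u 1ℤ refl (increment u u∈e u≢v) (pulse-other e v u∈e u≢v)
    at′ u (no u≢v) (no u∉e)   = shift u 0ℤ unmoved (unchanged u u∉e) (pulse-outside e v v∈e u∉e)
      where
      unmoved : lookup w u ⊕ residue 0ℤ ≡ lookup w u
      unmoved = trans (cong (_⊕ residue 0ℤ) (sym (residue-toℕ (lookup w u))))
        (trans (⊕-residue (lift w u) 0ℤ) (trans (cong residue (+-identityʳ (lift w u))) (residue-toℕ (lookup w u))))
    at : ∀ u → Null (lift w u + pulse e v u - lift w′ u)
    at u = at′ u (u ≟ v) (u ∈? edge e)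

  -- `Y` counts how often each vertex is fired along each edge in the given sequence.
  reachable-displacement : ∀ {w w′} → Reachable G w w′ → ∃[ Y ] (lift w ∔ displacement Y ≋ lift w′)
  reachable-displacement {w} ε = (λ _ _ → 0ℤ) , ≡⇒≋ (λ u →
    trans (cong (_+_ (lift w u)) (sum-zero _ λ e → sum-zero _ λ v → gate-0 (v ∈? edge e))) (+-identityʳ (lift w u)))
  reachable-displacement {w} (m ◅ r) =
    let (Y , eq) = reachable-displacement r
    in (λ f u → indicator e v f u + Y f u)
       , ≋-trans (≡⇒≋ λ u → trans (cong (_+_ (lift w u)) (trans (displacement-+ (indicator e v) Y u)
                   (cong (_+ displacement Y u) (displacement-indicator v∈e u)))) (ring (lift w u) (pulse e v u) (displacement Y u)))
           (≋-trans (∔-cong (displacement Y) (move-pulse m)) eq)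
    where
    open Move m
    ring : ∀ a b c → a + (b + c) ≡ a + b + c
    ring = solve-∀

  -- From states to configurations and the equivalence

  state-lift : ∀ w → state (lift w) ≡ w
  state-lift w = trans (tabulate-cong (residue-toℕ ∘ lookup w)) (tabulate∘lookup w)

  constant : ∀ w c → (∀ u → Null (lift w u - c)) → w ≡ replicate order (residue c)
  constant w c eq = begin
    w                                              ≡⟨ tabulate∘lookup w ⟨
    tabulate (lookup w)                            ≡⟨ tabulate-cong (λ u → trans (sym (residue-toℕ (lookup w u)))
                                                        (trans (residue-cong {lift w u} {c} (eq u)) (sym (lookup-replicate u (residue c))))) ⟩
    tabulate (lookup (replicate order (residue c))) ≡⟨ tabulate∘lookup (replicate order (residue c)) ⟩
    replicate order (residue c)                    ∎
    where open ≡-Reasoning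

  nonconstant : ∀ w c → w ≢ replicate order (residue c) → ∃[ u ] ¬ Null (lift w u - c)
  nonconstant w c w≢c = ¬∀⟶∃¬ order _ (λ u → null? (lift w u - c)) (w≢c ∘ constant w c)

  reach-along : ∀ {w₁ w₂} → w₁ ≢ replicate order 0ₚ → w₂ ≢ replicate order (⊝ 1ₚ) →
    Everything ⊢ lift w₁ ⇝ lift w₂ → lift w₁ ↝ lift w₂
  -- An empty sequence provides no edge to start from, but then the two ends already agree modulo
  -- `p`.
  reach-along _ _ (done eq) = ≋⇒↝ eq
  reach-along {w₁} {w₂} w₁≢0 w₂≢-1 r@(step {e} _ _ _) =
    let (u , w₁u≢0)   = nonconstant w₁ 0ℤ w₁≢0
        (u′ , w₂u′≢-1) = nonconstant w₂ (- 1ℤ) (λ eq → w₂≢-1 (trans eq (cong (replicate order) (sym (⊝-residue 1ℤ)))))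
    in reach-everything e (λ n → w₁u≢0 (null-≡ (sym (+-identityʳ (lift w₁ u))) n)) w₂u′≢-1 r

theorem1 : (p : ℕ) .{{_ : NonZero p}} → p ≥ 3 → 2 ∤ p →
    (G : Hypergraph) → Hypergraph.Good G →
    (w₁ w₂ : State G p) →
    w₁ ≢ replicate (Hypergraph.order G) 0ₚ →
    w₂ ≢ replicate (Hypergraph.order G) (⊝ 1ₚ) →
    Reachable G w₁ w₂ ⇔ (∃[ X ] SolvesH G w₁ w₂ X)
theorem1 p p≥3 2∤p G good w₁ w₂ w₁≢0 w₂≢-1 = mk⇔
    (λ r → let (Y , eq) = reachable-displacement r
           in (λ e v _ → residue (Y e v)) , Equivalence.from (SolvesH⇔ w₁ w₂ _ Y (λ _ _ _ → refl)) eq)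
    (λ (X , solves) → subst₂ (Reachable G) (state-lift w₁) (state-lift w₂)
      (moves (reach-along w₁≢0 w₂≢-1
        (⇝-trans (⇝-displacement (counts X) (lift w₁))
                 (done (Equivalence.to (SolvesH⇔ w₁ w₂ X (λ e v → + counts X e v) (counts-residue X)) solves))))))
  where
  open Residue p
  open Walk p p≥3 2∤p G good
  open Walk._↝_
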